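{- Let $n\geq 4$ be an integer, and let $(e_{1},e_{2},e_{3})$ be one of the triples $(1,2,3)$, $(1,2,4)$, $(-1,1,2)$. For each positive integer $k$ there are at least $k$ pairwise distinct $n$-tuples of integers having the same sum of $e$-th powers for each $e\in\{e_{1},e_{2},e_{3}\}$; that is, there are $k$ distinct $n$-tuples $(x_{1}^{(l)},\ldots,x_{n}^{(l)})\in\mathbb{Z}^{n}$, $l=1,\ldots,k$, such that for each $e\in\{e_{1},e_{2},e_{3}\}$ the value $\sum_{j=1}^{n}(x_{j}^{(l)})^{e}$ does not depend on $l$. Moreover, for any given positive integer $a$, these $n$-tuples can be chosen in such a way that their common sum $\sum_{j=1}^{n}x_{j}^{(l)}$ is divisible by $a$.
   Context: When the exponent $-1$ occurs, all entries of the $n$-tuples are required to be non-zero. -}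

module Defs where

open import Data.Fin using (Fin)
open import Data.Integer as ℤ using (ℤ; +_; -[1+_]; +[1+_]; 0ℤ; 1ℤ; -1ℤ)
open import Data.List as L using (List)
open import Data.Nat using (ℕ; suc)
open import Data.Rational as ℚ using (ℚ; 0ℚ)
open import Data.Vec using (Vec; []; _∷_; map; foldr′)
open import Data.Vec.Membership.Propositional using (_∈_)
open import Data.Vec.Relation.Unary.All using (All)
open import Function.Definitions using (Injective)
open import Relation.Binary.PropositionalEquality using (_≡_; _≢_)

-- The value at 0 is arbitrary; IsEqualPowerSumFamily excludes zero entries
-- whenever the exponent -1 occurs.
recip : ℤ → ℚ
recip (+ 0)    = 0ℚ
recip +[1+ m ] = 1ℤ ℚ./ suc m
recip -[1+ m ] = -1ℤ ℚ./ suc m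

infixr 8 _^ᶻ_

_^ᶻ_ : ℤ → ℤ → ℚ
x ^ᶻ (+ m)    = (x ℤ.^ m) ℚ./ 1
x ^ᶻ -[1+ m ] = recip (x ℤ.^ suc m)

powerSum : ∀ {n} → ℤ → Vec ℤ n → ℚ
powerSum e xs = foldr′ ℚ._+_ 0ℚ (map (_^ᶻ e) xs)

sumᶻ : ∀ {n} → Vec ℤ n → ℤ
sumᶻ = foldr′ ℤ._+_ 0ℤ

exponentTriples : List (Vec ℤ 3)
exponentTriples =
    (+ 1 ∷ + 2 ∷ + 3 ∷ [])
  L.∷ (+ 1 ∷ + 2 ∷ + 4 ∷ [])
  L.∷ (-1ℤ ∷ + 1 ∷ + 2 ∷ [])
  L.∷ L.[]

-- Distinctness is that of ordered tuples, i.e. of elements of ℤⁿ.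
record IsEqualPowerSumFamily {n k} (es : Vec ℤ 3) (x : Fin k → Vec ℤ n) : Set where
  field
    distinct  : Injective _≡_ _≡_ x
    nonzero   : -1ℤ ∈ es → ∀ l → All (_≢ 0ℤ) (x l)
    equalSums : ∀ {e} → e ∈ es → ∀ l l′ → powerSum e (x l) ≡ powerSum e (x l′)

{-# OPTIONS --safe #-}

-- The triples (1,2,3) and (-1,1,2) are served by the 4-tuples (x, y, -x, -y), whose odd power sums
-- vanish and whose sum of squares is 2(x² + y²); the triple (1,2,4) by (x, y, -x-y, 0), whose sum is 0
-- and whose sums of squares and fourth powers are 2Q and 2Q² with Q = x² + xy + y².
-- It remains to represent one integer k times by x² + cxy + y² with c = 0 or 1. The line
-- y = t(x + N) through the point (-N, 0) of x² + cxy + y² = N² meets this conic again at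
-- x = N(1 - t²)/d, y = Nt(2 + ct)/d with d = 1 + ct + t², and N may be any common multiple of the
-- denominators d. Padding with copies of a gives n-tuples whose sum is divisible by a.
module Submission where

open import Defs
open import Data.Fin using (Fin; toℕ)
open import Data.Fin.Properties using (toℕ-injective)
open import Data.Integer using (ℤ; +_; -[1+_]; +[1+_]; 0ℤ; 1ℤ; -1ℤ; _+_; _*_; _-_; -_; _^_; NonZero)
open import Data.Integer.Divisibility using (_∣_)
import Data.Integer.Divisibility.Signed as Signed
open import Data.Integer.Properties using (*-identityʳ; +-injective; pos-*; *-cancelʳ-≡; i*j≢0; neg-distribˡ-*; neg-injective)
open import Data.Integer.Solver using (module +-*-Solver)
open import Data.Integer.Tactic.RingSolver using (solve-∀)
import Data.List as List
open import Data.List.Membership.Propositional using (_∈_)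
open import Data.List.Membership.Propositional.Properties using (∈-tabulate⁺)
open import Data.List.Relation.Unary.All.Properties using (tabulate⁺)
open import Data.List.Relation.Unary.Any using (here; there)
open import Data.Nat as ℕ using (ℕ; suc; s≤s; z≤n; _≥_)
open import Data.Nat.Divisibility as ℕ using (quotient)
open import Data.Nat.ListAction using (product)
open import Data.Nat.ListAction.Properties using (∈⇒∣product; product≢0)
import Data.Nat.Properties as ℕ
open import Data.Product using (Σ-syntax; ∃-syntax; _×_; _,_; proj₁; proj₂)
open import Data.Rational as ℚ using (ℚ; 0ℚ)
import Data.Rational.Properties as ℚ
import Data.Rational.Solver as ℚ
open import Data.Rational.Unnormalised as ℚᵘ using (mkℚᵘ; *≡*)
import Data.Rational.Unnormalised.Properties as ℚᵘ
open import Data.Vec using (Vec; []; _∷_; map; replicate)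
open import Data.Vec.Properties using (∷-injectiveˡ; ∷-injectiveʳ)
open import Data.Vec.Relation.Unary.All using (All; []; _∷_)
open import Data.Vec.Relation.Unary.Any using (here; there)
open import Function.Definitions using (Injective)
open import Relation.Binary.PropositionalEquality

-- Rational power sums, integer power sums and reciprocals

/1-homo-+ : ∀ i j → i ℚ./ 1 ℚ.+ j ℚ./ 1 ≡ (i + j) ℚ./ 1
-- Division in `ℚ` normalises by a gcd, which does not compute on variables; the comparison is
-- therefore made between unnormalised fractions of denominator 1.
/1-homo-+ i j = ℚ.toℚᵘ-injective (begin
  ℚ.toℚᵘ (i ℚ./ 1 ℚ.+ j ℚ./ 1)              ≈⟨ ℚ.toℚᵘ-homo-+ (i ℚ./ 1) (j ℚ./ 1) ⟩
  ℚ.toℚᵘ (i ℚ./ 1) ℚᵘ.+ ℚ.toℚᵘ (j ℚ./ 1)    ≈⟨ ℚᵘ.+-cong (ℚ.toℚᵘ-fromℚᵘ (mkℚᵘ i 0)) (ℚ.toℚᵘ-fromℚᵘ (mkℚᵘ j 0)) ⟩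
  mkℚᵘ i 0 ℚᵘ.+ mkℚᵘ j 0                    ≈⟨ *≡* (cong (_* 1ℤ) (cong₂ _+_ (*-identityʳ i) (*-identityʳ j))) ⟩
  mkℚᵘ (i + j) 0                            ≈⟨ ℚ.toℚᵘ-fromℚᵘ (mkℚᵘ (i + j) 0) ⟨
  ℚ.toℚᵘ ((i + j) ℚ./ 1)                    ∎)
  where open import Relation.Binary.Reasoning.Setoid ℚᵘ.≃-setoid

powerSum-nonneg : ∀ m {n} (xs : Vec ℤ n) → powerSum (+ m) xs ≡ sumᶻ (map (_^ m) xs) ℚ./ 1
powerSum-nonneg m []       = refl
powerSum-nonneg m (x ∷ xs) = begin
  x ^ m ℚ./ 1 ℚ.+ powerSum (+ m) xs               ≡⟨ cong (x ^ m ℚ./ 1 ℚ.+_) (powerSum-nonneg m xs) ⟩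
  x ^ m ℚ./ 1 ℚ.+ sumᶻ (map (_^ m) xs) ℚ./ 1      ≡⟨ /1-homo-+ (x ^ m) _ ⟩
  (x ^ m + sumᶻ (map (_^ m) xs)) ℚ./ 1            ∎
  where open ≡-Reasoning

-- Reduces a rational power sum to an identity in `ℤ`, where the ring solver applies.
powerSum≡ : ∀ m {n} (xs : Vec ℤ n) {i} → sumᶻ (map (_^ m) xs) ≡ i → powerSum (+ m) xs ≡ i ℚ./ 1
powerSum≡ m xs refl = powerSum-nonneg m xs

recip-neg : ∀ i → recip (- i) ≡ ℚ.- recip i
recip-neg (+ 0)    = refl
recip-neg +[1+ m ] = refl
recip-neg -[1+ m ] = sym (neg-involutive (1ℤ ℚ./ suc m))
  where
  neg-involutive : ∀ p → ℚ.- (ℚ.- p) ≡ p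
  neg-involutive = solve 1 (λ p → :- (:- p) := p) refl
    where open ℚ.+-*-Solver

neg-^-1 : ∀ x → (- x) ^ᶻ -1ℤ ≡ ℚ.- (x ^ᶻ -1ℤ)
-- `x ^ 1` unfolds to `x * 1ℤ`, so the sign first has to be moved out of a product.
neg-^-1 x = trans (cong recip (sym (neg-distribˡ-* x 1ℤ))) (recip-neg (x ^ 1))

-- Integer points on the conics x² + cxy + y² = N²

commonMultiple : ∀ {k} (d : Fin k → ℕ) → (∀ i → ℕ.NonZero (d i)) →
                 ∃[ N ] (ℕ.NonZero N × (∀ i → d i ℕ.∣ N))
commonMultiple d d≢0 =
  product (List.tabulate d) ,
  product≢0 (tabulate⁺ d≢0) ,
  λ i → ∈⇒∣product (∈-tabulate⁺ i)

nonZero⇒≢0 : ∀ i .{{_ : NonZero i}} → i ≢ 0ℤ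
nonZero⇒≢0 (+ 0) {{()}}
nonZero⇒≢0 +[1+ _ ] ()
nonZero⇒≢0 -[1+ _ ] ()

record ConicPoints (c k : ℕ) : Set where
  field
    N                : ℤ
    x y              : Fin k → ℤ
    onConic          : ∀ i → x i * x i + + c * x i * y i + y i * y i ≡ N * N
    x≢0              : ∀ i → x i ≢ 0ℤ
    y≢0              : ∀ i → y i ≢ 0ℤ
    jointlyInjective : ∀ {i j} → x i ≡ x j → y i ≡ y j → i ≡ j

conicPoints : ∀ c k → ConicPoints c k
conicPoints c k = record
  { N = + N ; x = x ; y = y
  ; onConic = λ i → conic (+ c) (T i) (q i) (N≡ i)
  ; x≢0 = λ i → nonZero⇒≢0 (x i) {{i*j≢0 (q i) (1ℤ - T i * T i) {{q-nonZero i}}}}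
  ; y≢0 = λ i → nonZero⇒≢0 (y i) {{i*j≢0 (T i) (x i + + N) {{_}} {{x+N-nonZero i}}}}
  ; jointlyInjective = inj
  }
  where
  t : Fin k → ℕ
  -- Slopes start at 2 because t = 0 gives y = 0 and t = 1 gives x = 0.
  t i = 2 ℕ.+ toℕ i
  T q x y : Fin k → ℤ
  T i = + t i
  d : Fin k → ℕ
  d i = 1 ℕ.+ t i ℕ.* (c ℕ.+ t i)
  cm = commonMultiple d (λ _ → _)
  N = proj₁ cm
  d∣N = proj₂ (proj₂ cm)
  -- `q i` is N / d, which clears the denominator of the second intersection point; y is then read
  -- off the equation of the line.
  q i = + quotient (d∣N i)
  x i = q i * (1ℤ - T i * T i)
  y i = T i * (x i + + N)

  N≡ : ∀ i → + N ≡ q i * (1ℤ + T i * (+ c + T i))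
  N≡ i = trans (cong +_ (ℕ._∣_.equality (d∣N i)))
    (trans (pos-* (quotient (d∣N i)) (d i)) (cong (λ z → q i * (1ℤ + z)) (pos-* (t i) (c ℕ.+ t i))))

  q-nonZero : ∀ i → NonZero (q i)
  q-nonZero i = ℕ.m*n≢0⇒m≢0 (quotient (d∣N i)) {{subst ℕ.NonZero (ℕ._∣_.equality (d∣N i)) (proj₁ (proj₂ cm))}}

  -- The terms in t² cancel, and the remaining factor 2 + ct is positive. Hence no point has x = -N,
  -- on which both y ≠ 0 and the recovery of the slope rely.
  x+N≡ : ∀ i → x i + + N ≡ q i * (+ 2 + + c * T i)
  x+N≡ i rewrite N≡ i = eq (+ c) (T i) (q i)
    where
    eq : ∀ c T q → q * (1ℤ - T * T) + q * (1ℤ + T * (c + T)) ≡ q * (+ 2 + c * T)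
    eq = solve-∀

  x+N-nonZero : ∀ i → NonZero (x i + + N)
  x+N-nonZero i = subst NonZero (sym (trans (x+N≡ i) (cong (λ z → q i * (+ 2 + z)) (sym (pos-* c (t i))))))
    (i*j≢0 (q i) (+ (2 ℕ.+ c ℕ.* t i)) {{q-nonZero i}})

  conic : ∀ c T q {N} → N ≡ q * (1ℤ + T * (c + T)) →
          let x = q * (1ℤ - T * T); y = T * (x + N) in
          x * x + c * x * y + y * y ≡ N * N
  conic c T q refl = eq c T q
    where
    eq : ∀ c T q → let N = q * (1ℤ + T * (c + T)); x = q * (1ℤ - T * T); y = T * (x + N) in
         x * x + c * x * y + y * y ≡ N * N
    eq = solve-∀

  inj : ∀ {i j} → x i ≡ x j → y i ≡ y j → i ≡ j
  -- The slope is recovered from the point as t = y / (x + N), and the slope determines the index.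
  inj {i} {j} xi≡xj yi≡yj = toℕ-injective (ℕ.+-cancelˡ-≡ 2 _ _ (+-injective
    (*-cancelʳ-≡ (T i) (T j) (x i + + N) {{x+N-nonZero i}}
      (trans yi≡yj (cong (λ z → T j * (z + + N)) (sym xi≡xj))))))

-- Power sums of the two shapes of tuples

antipodal : ∀ {n} → ℤ → ℤ → Vec ℤ n → Vec ℤ (4 ℕ.+ n)
antipodal x y s = x ∷ y ∷ - x ∷ - y ∷ s

triangular : ∀ {n} → ℤ → ℤ → Vec ℤ n → Vec ℤ (4 ℕ.+ n)
triangular x y s = x ∷ y ∷ - (x + y) ∷ 0ℤ ∷ s

module _ {n : ℕ} (x y : ℤ) (s : Vec ℤ n) where

  private
    S : ℕ → ℤ
    S m = sumᶻ (map (_^ m) s)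

  sum-antipodal : sumᶻ (antipodal x y s) ≡ sumᶻ s
  sum-antipodal = eq x y (sumᶻ s)
    where
    eq : ∀ x y S → x + (y + (- x + (- y + S))) ≡ S
    eq = solve-∀

  sum-triangular : sumᶻ (triangular x y s) ≡ sumᶻ s
  sum-triangular = eq x y (sumᶻ s)
    where
    eq : ∀ x y S → x + (y + (- (x + y) + (0ℤ + S))) ≡ S
    eq = solve-∀

  antipodal-^1 : powerSum (+ 1) (antipodal x y s) ≡ S 1 ℚ./ 1
  antipodal-^1 = powerSum≡ 1 (antipodal x y s) (solve 3 (λ x y S →
    x :^ 1 :+ (y :^ 1 :+ ((:- x) :^ 1 :+ ((:- y) :^ 1 :+ S))) := S) refl x y (S 1))
    where open +-*-Solver

  -- The term `0ℤ * x * y` is kept so that the quadratic form matches `onConic` at c = 0.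
  antipodal-^2 : powerSum (+ 2) (antipodal x y s) ≡
                 (+ 2 * (x * x + 0ℤ * x * y + y * y) + S 2) ℚ./ 1
  antipodal-^2 = powerSum≡ 2 (antipodal x y s) (solve 3 (λ x y S →
    x :^ 2 :+ (y :^ 2 :+ ((:- x) :^ 2 :+ ((:- y) :^ 2 :+ S))) :=
    con (+ 2) :* (x :* x :+ con 0ℤ :* x :* y :+ y :* y) :+ S) refl x y (S 2))
    where open +-*-Solver

  antipodal-^3 : powerSum (+ 3) (antipodal x y s) ≡ S 3 ℚ./ 1
  antipodal-^3 = powerSum≡ 3 (antipodal x y s) (solve 3 (λ x y S →
    x :^ 3 :+ (y :^ 3 :+ ((:- x) :^ 3 :+ ((:- y) :^ 3 :+ S))) := S) refl x y (S 3))
    where open +-*-Solver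

  -- Inversion is odd, so opposite entries cancel once their reciprocals are treated as independent
  -- rational variables.
  antipodal-^-1 : powerSum -1ℤ (antipodal x y s) ≡ powerSum -1ℤ s
  antipodal-^-1 rewrite neg-^-1 x | neg-^-1 y =
    solve 3 (λ p r S → p :+ (r :+ (:- p :+ (:- r :+ S))) := S) refl (x ^ᶻ -1ℤ) (y ^ᶻ -1ℤ) (powerSum -1ℤ s)
    where open ℚ.+-*-Solver

  triangular-^1 : powerSum (+ 1) (triangular x y s) ≡ S 1 ℚ./ 1
  triangular-^1 = powerSum≡ 1 (triangular x y s) (solve 3 (λ x y S →
    x :^ 1 :+ (y :^ 1 :+ ((:- (x :+ y)) :^ 1 :+ (con 0ℤ :^ 1 :+ S))) := S) refl x y (S 1))
    where open +-*-Solver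

  triangular-^2 : powerSum (+ 2) (triangular x y s) ≡
                  (+ 2 * (x * x + 1ℤ * x * y + y * y) + S 2) ℚ./ 1
  triangular-^2 = powerSum≡ 2 (triangular x y s) (solve 3 (λ x y S →
    x :^ 2 :+ (y :^ 2 :+ ((:- (x :+ y)) :^ 2 :+ (con 0ℤ :^ 2 :+ S))) :=
    con (+ 2) :* (x :* x :+ con 1ℤ :* x :* y :+ y :* y) :+ S) refl x y (S 2))
    where open +-*-Solver

  -- For three numbers with sum 0, the sum of fourth powers is half the square of the sum of
  -- squares.
  triangular-^4 : powerSum (+ 4) (triangular x y s) ≡
                  (+ 2 * (x * x + 1ℤ * x * y + y * y) ^ 2 + S 4) ℚ./ 1
  triangular-^4 = powerSum≡ 4 (triangular x y s) (solve 3 (λ x y S →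
    x :^ 4 :+ (y :^ 4 :+ ((:- (x :+ y)) :^ 4 :+ (con 0ℤ :^ 4 :+ S))) :=
    con (+ 2) :* (x :* x :+ con 1ℤ :* x :* y :+ y :* y) :^ 2 :+ S) refl x y (S 4))
    where open +-*-Solver

-- Families with equal power sums

module _ {k n : ℕ} (s : Vec ℤ n) where

  private
    module A = ConicPoints (conicPoints 0 k)
    module B = ConicPoints (conicPoints 1 k)

  antipodalFamily triangularFamily : Fin k → Vec ℤ (4 ℕ.+ n)
  antipodalFamily  l = antipodal  (A.x l) (A.y l) s
  triangularFamily l = triangular (B.x l) (B.y l) s

  sum-antipodalFamily : ∀ l → sumᶻ (antipodalFamily l) ≡ sumᶻ s
  sum-antipodalFamily l = sum-antipodal (A.x l) (A.y l) s

  sum-triangularFamily : ∀ l → sumᶻ (triangularFamily l) ≡ sumᶻ s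
  sum-triangularFamily l = sum-triangular (B.x l) (B.y l) s

  private
    antipodal-distinct : Injective _≡_ _≡_ antipodalFamily
    antipodal-distinct eq = A.jointlyInjective (∷-injectiveˡ eq) (∷-injectiveˡ (∷-injectiveʳ eq))

    triangular-distinct : Injective _≡_ _≡_ triangularFamily
    triangular-distinct eq = B.jointlyInjective (∷-injectiveˡ eq) (∷-injectiveˡ (∷-injectiveʳ eq))

    -- A power sum that depends on x and y only through the quadratic form is the same for all
    -- members, since the form takes the value N² at each of them. For odd exponents `f` is
    -- constant.
    antipodal-equal : ∀ e (f : ℤ → ℚ) →
      (∀ x y → powerSum e (antipodal x y s) ≡ f (x * x + 0ℤ * x * y + y * y)) →
      ∀ l l′ → powerSum e (antipodalFamily l) ≡ powerSum e (antipodalFamily l′)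
    antipodal-equal _ f h l l′ =
      trans (h _ _) (trans (cong f (trans (A.onConic l) (sym (A.onConic l′)))) (sym (h _ _)))

    triangular-equal : ∀ e (f : ℤ → ℚ) →
      (∀ x y → powerSum e (triangular x y s) ≡ f (x * x + 1ℤ * x * y + y * y)) →
      ∀ l l′ → powerSum e (triangularFamily l) ≡ powerSum e (triangularFamily l′)
    triangular-equal _ f h l l′ =
      trans (h _ _) (trans (cong f (trans (B.onConic l) (sym (B.onConic l′)))) (sym (h _ _)))

  antipodal₁₂₃ : IsEqualPowerSumFamily (+ 1 ∷ + 2 ∷ + 3 ∷ []) antipodalFamily
  antipodal₁₂₃ = record
    { distinct  = antipodal-distinct
    ; nonzero   = λ { (there (there (there ()))) }
    ; equalSums = λ
      { (here refl)                 → antipodal-equal (+ 1) _ (λ x y → antipodal-^1 x y s)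
      ; (there (here refl))         → antipodal-equal (+ 2) (λ Q → (+ 2 * Q + _) ℚ./ 1) (λ x y → antipodal-^2 x y s)
      ; (there (there (here refl))) → antipodal-equal (+ 3) _ (λ x y → antipodal-^3 x y s)
      }
    }

  triangular₁₂₄ : IsEqualPowerSumFamily (+ 1 ∷ + 2 ∷ + 4 ∷ []) triangularFamily
  triangular₁₂₄ = record
    { distinct  = triangular-distinct
    ; nonzero   = λ { (there (there (there ()))) }
    ; equalSums = λ
      { (here refl)                 → triangular-equal (+ 1) _ (λ x y → triangular-^1 x y s)
      ; (there (here refl))         → triangular-equal (+ 2) (λ Q → (+ 2 * Q + _) ℚ./ 1) (λ x y → triangular-^2 x y s)
      ; (there (there (here refl))) → triangular-equal (+ 4) (λ Q → (+ 2 * Q ^ 2 + _) ℚ./ 1) (λ x y → triangular-^4 x y s)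
      }
    }

  antipodal₋₁₁₂ : All (_≢ 0ℤ) s → IsEqualPowerSumFamily (-1ℤ ∷ + 1 ∷ + 2 ∷ []) antipodalFamily
  antipodal₋₁₁₂ s≢0 = record
    { distinct  = antipodal-distinct
    ; nonzero   = λ _ l → A.x≢0 l ∷ A.y≢0 l ∷ neg≢0 (A.x≢0 l) ∷ neg≢0 (A.y≢0 l) ∷ s≢0
    ; equalSums = λ
      { (here refl)                 → antipodal-equal -1ℤ _ (λ x y → antipodal-^-1 x y s)
      ; (there (here refl))         → antipodal-equal (+ 1) _ (λ x y → antipodal-^1 x y s)
      ; (there (there (here refl))) → antipodal-equal (+ 2) (λ Q → (+ 2 * Q + _) ℚ./ 1) (λ x y → antipodal-^2 x y s)
      }
    }
    where
    neg≢0 : ∀ {i} → i ≢ 0ℤ → - i ≢ 0ℤ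
    neg≢0 i≢0 -i≡0 = i≢0 (neg-injective -i≡0)

-- Padding and divisibility of the common sum

All-replicate : ∀ {P : ℤ → Set} n {i} → P i → All P (replicate n i)
All-replicate 0       p = []
All-replicate (suc n) p = p ∷ All-replicate n p

∣sum-replicate : ∀ n i → i Signed.∣ sumᶻ (replicate n i)
∣sum-replicate 0       i = Signed.divides 0ℤ refl
∣sum-replicate (suc n) i = Signed.∣m∣n⇒∣m+n Signed.∣-refl (∣sum-replicate n i)

familyDivisibleBy : ∀ n {es} → es ∈ exponentTriples → ∀ k a → a ≥ 1 →
  Σ[ x ∈ (Fin k → Vec ℤ (4 ℕ.+ n)) ] (IsEqualPowerSumFamily es x × (∀ l → (+ a) ∣ sumᶻ (x l)))
familyDivisibleBy n es∈ k a@(suc _) a≥1 = choose es∈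
  where
  s : Vec ℤ n
  -- The first four entries add up to 0, so the total is n copies of a. As a is positive, the
  -- padding also respects the nonvanishing demanded by the exponent -1.
  s = replicate n (+ a)

  divides : ∀ {i} → i ≡ sumᶻ s → (+ a) ∣ i
  divides refl = Signed.∣⇒∣ᵤ (∣sum-replicate n (+ a))

  choose : ∀ {es} → es ∈ exponentTriples →
    Σ[ x ∈ (Fin k → Vec ℤ (4 ℕ.+ n)) ] (IsEqualPowerSumFamily es x × (∀ l → (+ a) ∣ sumᶻ (x l)))
  choose (here refl)                 = antipodalFamily s , antipodal₁₂₃ s , λ l → divides (sum-antipodalFamily s l)
  choose (there (here refl))         = triangularFamily s , triangular₁₂₄ s , λ l → divides (sum-triangularFamily s l)
  choose (there (there (here refl))) = antipodalFamily s , antipodal₋₁₁₂ s (All-replicate n λ ()) ,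
    λ l → divides (sum-antipodalFamily s l)

corollary3p4 : (n : ℕ) → n ≥ 4 →
    (es : Vec ℤ 3) → es ∈ exponentTriples →
    (k : ℕ) → k ≥ 1 →
    (Σ[ x ∈ (Fin k → Vec ℤ n) ] IsEqualPowerSumFamily es x)
    × ((a : ℕ) → a ≥ 1 →
    Σ[ x ∈ (Fin k → Vec ℤ n) ]
    (IsEqualPowerSumFamily es x × (∀ l → (+ a) ∣ sumᶻ (x l))))
corollary3p4 (suc (suc (suc (suc n)))) (s≤s (s≤s (s≤s (s≤s _)))) es es∈ k _ =
  -- Every integer is divisible by 1, so a = 1 yields the first claim.
  (let x , family , _ = familyDivisibleBy n es∈ k 1 (s≤s z≤n) in x , family) ,
  familyDivisibleBy n es∈ k
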